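{- For every integer $k\ge 1$, $$\delta(k)=\tfrac12 k+O(\log k)\qquad (k\to\infty),$$ where $\delta(k)$ is as defined in the context. That is, there is an absolute constant $C$ such that $|\delta(k)-\tfrac12 k|\le C\log(k+1)$ for all $k\ge1$.
   Context: A function $f:\mathbb{N}\to\{+1,-1\}$ is completely multiplicative if $f(ab)=f(a)f(b)$ for all $a,b\in\mathbb{N}$. For an integer $q>1$ and a real-valued (i.e. $\{0,\pm1\}$-valued) Dirichlet character $\chi_q$ modulo $q$ (principal or not, primitive or not), a modified character $\tilde\chi_q$ is the completely multiplicative function $\mathbb{N}\to\{+1,-1\}$ defined on primes by $\tilde\chi_q(p)=\chi_q(p)$ if $p\nmid q$, and $\tilde\chi_q(p)=\eta(p)$ if $p\mid q$, where $\eta(p)\in\{+1,-1\}$ is an arbitrary choice of sign for each prime $p\mid q$. For such $\tilde\chi_q$ and $k\ge1$ set $$\delta(\tilde\chi_q;k)=\min_{n\in\mathbb{N}\cup\{0\}}\#\{1\le m\le k:\ \tilde\chi_q(n+m)=-1\},$$ the least number of $-1$ values of $\tilde\chi_q$ in a block of $k$ consecutive positive integers (this is the number of primes at which $\tilde\chi_q$ must be modified so that it takes the value $+1$ at $k$ consecutive integers). Define $\delta(k)=\sup\delta(\tilde\chi_q;k)$, the supremum over all integers $q>1$, all real Dirichlet characters $\chi_q$ mod $q$ and all sign choices $\eta$. -}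

module Defs where

open import Data.Integer as ℤ using (ℤ; 0ℤ; 1ℤ; -1ℤ; _◃_)
open import Data.List using (length; filter; applyUpTo)
open import Data.List.Properties using (length-filter; length-applyUpTo)
open import Data.Nat
open import Data.Nat.Coprimality using (Coprime)
open import Data.Nat.Divisibility using (_∣_; _∤_)
open import Data.Nat.Primality using (Prime)
open import Data.Nat.Properties
open import Data.Product using (∃; ∃-syntax; _×_; _,_)
open import Data.Sign as Sign using (Sign)
open import Data.Sum using (_⊎_; inj₁; inj₂)
open import Function using (_⇔_)
open import Relation.Binary.PropositionalEquality
open import Relation.Nullary using (¬_)

-- A Dirichlet character is given by its values on ℕ (including 0), which by
-- periodicity determine those on ℤ.
record IsRealDirichletCharacter (q : ℕ) (χ : ℕ → ℤ) : Set where
  field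
    periodic       : ∀ n → χ (n + q) ≡ χ n
    multiplicative : ∀ a b → χ (a * b) ≡ χ a ℤ.* χ b
    support        : ∀ n → χ n ≢ 0ℤ ⇔ Coprime n q
    real           : ∀ n → χ n ≡ 0ℤ ⊎ χ n ≡ 1ℤ ⊎ χ n ≡ -1ℤ

-- Functions on the positive integers are represented by functions on ℕ whose
-- value at 0 is irrelevant. Without the NonZero conditions, taking a = 0 would
-- force f b = + for every b.
CompletelyMultiplicative : (ℕ → Sign) → Set
CompletelyMultiplicative f =
  ∀ a b → .{{NonZero a}} → .{{NonZero b}} → f (a * b) ≡ f a Sign.* f b

-- f is the modified character obtained from χ modulo q and the signs η, of
-- which only the values at the primes dividing q matter. The integer f p ◃ 1
-- is +1 or -1 according to the sign f p.
record IsModifiedCharacter (q : ℕ) (χ : ℕ → ℤ) (η f : ℕ → Sign) : Set where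
  field
    completelyMultiplicative : CompletelyMultiplicative f
    unmodified : ∀ p → Prime p → p ∤ q → f p ◃ 1 ≡ χ p
    modified   : ∀ p → Prime p → p ∣ q → f p ≡ η p

-- #{1 ≤ m ≤ k : f (n + m) = -1}
negatives : (ℕ → Sign) → ℕ → ℕ → ℕ
negatives f k n = length (filter (λ m → f (n + m) Sign.≟ Sign.-) (applyUpTo suc k))

IsMinimum : (ℕ → ℕ) → ℕ → Set
IsMinimum g d = (∃[ n ] g n ≡ d) × (∀ n → d ≤ g n)

IsUpperBound : (ℕ → Set) → ℕ → Set
IsUpperBound P b = ∀ e → P e → e ≤ b

IsSupremum : (ℕ → Set) → ℕ → Set
IsSupremum P d = IsUpperBound P d × (∀ b → IsUpperBound P b → d ≤ b)

-- δ(f; k) = d. A relation, because the minimum is over infinitely many n.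
IsMinNegatives : (ℕ → Sign) → ℕ → ℕ → Set
IsMinNegatives f k d = IsMinimum (negatives f k) d

-- e = δ(f; k) for some modified real character f of some modulus q > 1.
IsModifiedCharacterValue : ℕ → ℕ → Set
IsModifiedCharacterValue k e =
  ∃[ q ] ∃[ χ ] ∃[ η ] ∃[ f ]
    1 < q × IsRealDirichletCharacter q χ × IsModifiedCharacter q χ η f ×
    IsMinNegatives f k e

-- δ(k) = d.
IsDelta : ℕ → ℕ → Set
IsDelta k d = IsSupremum (IsModifiedCharacterValue k) d

-- The relations IsMinNegatives f k and IsDelta k are single-valued, and each
-- holds of some number classically (constructively, up to double negation).

minimum-unique : ∀ {g d e} → IsMinimum g d → IsMinimum g e → d ≡ e
minimum-unique ((m , refl) , d≤) ((n , refl) , e≤) = ≤-antisym (d≤ n) (e≤ m)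

supremum-unique : ∀ {P d e} → IsSupremum P d → IsSupremum P e → d ≡ e
supremum-unique (ub , least) (ub′ , least′) = ≤-antisym (least _ ub′) (least′ _ ub)

minimum-exists : ∀ g → ¬ ¬ ∃ (IsMinimum g)
minimum-exists g none = go (g 0) 0 ≤-refl
  where
  go : ∀ b n → ¬ (g n ≤ b)
  go zero    n gn≤0 = none (g n , (n , refl) , λ m → ≤-trans gn≤0 z≤n)
  go (suc b) n gn≤1+b = none
    (g n , (n , refl) , λ m → ≤-trans gn≤1+b (≰⇒> (go b m)))

supremum-exists : ∀ P b → IsUpperBound P b → ¬ ¬ ∃ (IsSupremum P)
supremum-exists P zero    ub none = none (0 , ub , λ _ _ → z≤n)
supremum-exists P (suc b) ub none = supremum-exists P b ub′ none
  where
  ub′ : IsUpperBound P b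
  ub′ e Pe with m≤n⇒m<n∨m≡n (ub e Pe)
  ... | inj₁ e<1+b = s≤s⁻¹ e<1+b
  ... | inj₂ refl with () ← none (e , ub , λ c ubc → ubc e Pe)

negatives≤k : ∀ f k n → negatives f k n ≤ k
negatives≤k f k n = subst (negatives f k n ≤_) (length-applyUpTo suc k)
  (length-filter (λ m → f (n + m) Sign.≟ Sign.-) (applyUpTo suc k))

minNegatives-exists : ∀ f k → ¬ ¬ ∃ (IsMinNegatives f k)
minNegatives-exists f k = minimum-exists (negatives f k)

delta-exists : ∀ k → ¬ ¬ ∃ (IsDelta k)
delta-exists k = supremum-exists (IsModifiedCharacterValue k) k
  λ { e (_ , _ , _ , f , _ , _ , _ , (n , refl) , _) → negatives≤k f k n }

{-# OPTIONS --safe #-}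

-- Upper bound, δ(k) ≤ k/2. For completely multiplicative f : ℕ → {±1} the divisor
-- sums f ∗ 1 are nonnegative, so Σ_{d ≤ N} S(N/d) ≥ 0 for the partial sums S of f.
-- If f had a negative sum over every block of length k, then S(x) ≤ k - ⌊x/k⌋, and
-- for N = k 2^L the divergence of the harmonic series makes the sum over d negative.
--
-- Lower bound. Extend the nonprincipal character χ₃ mod 3 by f₃ 3 = +1. Its partial
-- sums satisfy S(x) = Σ_{n ≤ x} χ₃(n) + S(x/3), the first term being 0 or 1, so the
-- sum over a block of length k is at most 1 + log₂ k in absolute value.
module Submission where

open import Algebra.Properties.CommutativeSemigroup using (interchange)
open import Data.Integer as ℤ using (ℤ; +_; 0ℤ; 1ℤ; -1ℤ; _◃_)
import Data.Integer.Properties as ℤ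
import Data.Integer.Tactic.RingSolver as ℤ
open import Data.List using ([]; _∷_; [_]; _++_; length; filter; applyUpTo)
open import Data.List.Properties using (applyUpTo-∷ʳ; filter-++; length-++)
open import Data.List.Relation.Unary.All using (_∷_)
open import Data.Nat
open import Data.Nat.Coprimality using (Coprime)
open import Data.Nat.Divisibility
open import Data.Nat.DivMod
open import Data.Nat.Induction using (<-wellFounded; Acc; acc)
open import Data.Nat.ListAction using (product)
open import Data.Nat.Logarithm using (⌊log₂_⌋; ⌊log₂⌋-mono-≤; ⌊log₂[2*b]⌋≡1+⌊log₂b⌋)
open import Data.Nat.Primality
open import Data.Nat.Primality.Factorisation using (factorise)
open import Data.Nat.Properties
import Data.Nat.Tactic.RingSolver as ℕ
open import Data.Product using (∃-syntax; _×_; _,_)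
open import Data.Sign as Sign using (Sign)
open import Data.Sum using (_⊎_; inj₁; inj₂)
open import Defs
open import Function using (_∘_; it; mk⇔)
open import Relation.Binary.PropositionalEquality hiding ([_])
open import Relation.Nullary using (¬_; yes; no; contradiction)
open import Relation.Nullary.Decidable using (toWitness; decidable-stable)

-- Finite sums

∑ : ℕ → (ℕ → ℤ) → ℤ
∑ zero    g = 0ℤ
∑ (suc N) g = ∑ N g ℤ.+ g N

∑-cong : ∀ {g h} N → (∀ j → g j ≡ h j) → ∑ N g ≡ ∑ N h
∑-cong zero    g≡h = refl
∑-cong (suc N) g≡h = cong₂ ℤ._+_ (∑-cong N g≡h) (g≡h N)

∑-mono : ∀ {g h} N → (∀ j → j < N → g j ℤ.≤ h j) → ∑ N g ℤ.≤ ∑ N h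
∑-mono zero    g≤h = ℤ.≤-refl
∑-mono (suc N) g≤h =
  ℤ.+-mono-≤ (∑-mono N λ j j<N → g≤h j (m<n⇒m<1+n j<N)) (g≤h N ≤-refl)

∑-nonneg : ∀ {g} N → (∀ j → j < N → 0ℤ ℤ.≤ g j) → 0ℤ ℤ.≤ ∑ N g
∑-nonneg zero    0≤g = ℤ.≤-refl
∑-nonneg (suc N) 0≤g =
  ℤ.+-mono-≤ (∑-nonneg N λ j j<N → 0≤g j (m<n⇒m<1+n j<N)) (0≤g N ≤-refl)

∑-const : ∀ N c → ∑ N (λ _ → c) ≡ + N ℤ.* c
∑-const zero    c = sym (ℤ.*-zeroˡ c)
∑-const (suc N) c = begin
  ∑ N (λ _ → c) ℤ.+ c  ≡⟨ cong (ℤ._+ c) (∑-const N c) ⟩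
  + N ℤ.* c ℤ.+ c      ≡⟨ ℤ.+-comm _ c ⟩
  c ℤ.+ + N ℤ.* c      ≡⟨ ℤ.suc-* (+ N) c ⟨
  + suc N ℤ.* c        ∎
  where open ≡-Reasoning

∑-+ : ∀ N g h → ∑ N (λ j → g j ℤ.+ h j) ≡ ∑ N g ℤ.+ ∑ N h
∑-+ zero    g h = refl
∑-+ (suc N) g h = trans (cong (ℤ._+ (g N ℤ.+ h N)) (∑-+ N g h))
  (interchange ℤ.+-commutativeSemigroup (∑ N g) (∑ N h) (g N) (h N))

∑-* : ∀ N c g → ∑ N (λ j → c ℤ.* g j) ≡ c ℤ.* ∑ N g
∑-* zero    c g = sym (ℤ.*-zeroʳ c)
∑-* (suc N) c g =
  trans (cong (ℤ._+ (c ℤ.* g N)) (∑-* N c g)) (sym (ℤ.*-distribˡ-+ c (∑ N g) (g N)))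

∑-swap : ∀ M N (g : ℕ → ℕ → ℤ) →
  ∑ M (λ i → ∑ N (g i)) ≡ ∑ N (λ j → ∑ M (λ i → g i j))
∑-swap zero    N g = sym (trans (∑-const N 0ℤ) (ℤ.*-zeroʳ (+ N)))
∑-swap (suc M) N g =
  trans (cong (ℤ._+ ∑ N (g M)) (∑-swap M N g)) (sym (∑-+ N (λ j → ∑ M (λ i → g i j)) (g M)))

∑-++ : ∀ M N g → ∑ (M + N) g ≡ ∑ M g ℤ.+ ∑ N (λ j → g (M + j))
∑-++ M zero    g rewrite +-identityʳ M = sym (ℤ.+-identityʳ _)
∑-++ M (suc N) g rewrite +-suc M N =
  trans (cong (ℤ._+ g (M + N)) (∑-++ M N g)) (ℤ.+-assoc (∑ M g) _ _)

∑-truncate : ∀ {M N} g → M ≤ N → (∀ j → M ≤ j → g j ≡ 0ℤ) → ∑ N g ≡ ∑ M g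
∑-truncate {M} {N} g M≤N g≡0 = begin
  ∑ N g                                    ≡⟨ cong (λ n → ∑ n g) (m+[n∸m]≡n M≤N) ⟨
  ∑ (M + (N ∸ M)) g                        ≡⟨ ∑-++ M (N ∸ M) g ⟩
  ∑ M g ℤ.+ ∑ (N ∸ M) (λ j → g (M + j))    ≡⟨ cong (ℤ._+_ (∑ M g)) tail≡0 ⟩
  ∑ M g ℤ.+ 0ℤ                             ≡⟨ ℤ.+-identityʳ _ ⟩
  ∑ M g                                    ∎
  where
  open ≡-Reasoning
  tail≡0 : ∑ (N ∸ M) (λ j → g (M + j)) ≡ 0ℤ
  tail≡0 = begin
    ∑ (N ∸ M) (λ j → g (M + j))  ≡⟨ ∑-cong (N ∸ M) (λ j → g≡0 (M + j) (m≤m+n M j)) ⟩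
    ∑ (N ∸ M) (λ _ → 0ℤ)         ≡⟨ ∑-const (N ∸ M) 0ℤ ⟩
    + (N ∸ M) ℤ.* 0ℤ             ≡⟨ ℤ.*-zeroʳ (+ (N ∸ M)) ⟩
    0ℤ                           ∎

-- For fixed `d` this lives on the multiples of `d`; for fixed `n` it gives the terms of a sum over
-- the divisors `d` of `n`. Padding with 0 lets both kinds of sum run over full ranges and be
-- interchanged.
dilate : ℕ → (ℕ → ℤ) → ℕ → ℤ
dilate d g n with d ∣? n
... | yes (divides q _) = g q
... | no _              = 0ℤ

dilate-∣ : ∀ d .{{_ : NonZero d}} g q → dilate d g (q * d) ≡ g q
dilate-∣ d g q with d ∣? (q * d)
... | yes (divides q′ eq) = cong g (*-cancelʳ-≡ q′ q d (sym eq))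
... | no d∤qd             = contradiction (divides q refl) d∤qd

dilate-∤ : ∀ {d n} g → d ∤ n → dilate d g n ≡ 0ℤ
dilate-∤ {d} {n} g d∤n with d ∣? n
... | yes d∣n = contradiction d∣n d∤n
... | no _    = refl

-- Going down one index at a time, only the step at remainder 0 meets a multiple of `d`; it lowers
-- the quotient by one and resets the remainder to its largest value.
∑-dilate-% : ∀ d .{{_ : NonZero d}} g q r → r < d →
  ∑ (r + q * d) (dilate d g ∘ suc) ≡ ∑ q (g ∘ suc)
∑-dilate-% d g zero zero _ = refl
∑-dilate-% (suc d) g (suc q) zero _ =
  cong₂ ℤ._+_ (∑-dilate-% (suc d) g q d ≤-refl) (dilate-∣ (suc d) g (suc q))
∑-dilate-% d g q (suc r) 1+r<d = begin
  ∑ (r + q * d) (dilate d g ∘ suc) ℤ.+ dilate d g (suc r + q * d)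
    ≡⟨ cong₂ ℤ._+_ (∑-dilate-% d g q r (≤-trans (n≤1+n _) 1+r<d)) (dilate-∤ g d∤) ⟩
  ∑ q (g ∘ suc) ℤ.+ 0ℤ
    ≡⟨ ℤ.+-identityʳ _ ⟩
  ∑ q (g ∘ suc) ∎
  where
  open ≡-Reasoning
  d∤ : d ∤ suc r + q * d
  d∤ d∣ = <⇒≱ 1+r<d (∣⇒≤ (∣m+n∣m⇒∣n (subst (d ∣_) (+-comm (suc r) (q * d)) d∣) (n∣m*n q)))

∑-dilate : ∀ d .{{_ : NonZero d}} g N → ∑ N (dilate d g ∘ suc) ≡ ∑ (N / d) (g ∘ suc)
∑-dilate d g N = trans
  (cong (λ n → ∑ n (dilate d g ∘ suc)) (m≡m%n+[m/n]*n N d))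
  (∑-dilate-% d g (N / d) (N % d) (m%n<n N d))

coprimePart : ℕ → (ℕ → ℤ) → ℕ → ℤ
coprimePart p g d with p ∣? d
... | yes _ = 0ℤ
... | no _  = g d

-- Splits a sum over `d` by whether `p` divides `d`; the multiples d = ep are reindexed by `e`, so
-- that `∑-dilate-%` evaluates their share.
coprimePart+dilate : ∀ p g d → g d ≡ coprimePart p g d ℤ.+ dilate p (λ e → g (e * p)) d
coprimePart+dilate p g d with p ∣? d
... | yes (divides e refl) = sym (ℤ.+-identityˡ _)
... | no _                 = sym (ℤ.+-identityʳ _)

-- Divisor sums of completely multiplicative functions

-- The value (g ∗ 1)(n) of the Dirichlet convolution.
divisorSum : (ℕ → ℤ) → ℕ → ℤ
divisorSum g n = ∑ n (λ j → dilate (suc j) g n)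

coprimeDivisorSum : ℕ → (ℕ → ℤ) → ℕ → ℤ
coprimeDivisorSum p g n = ∑ n (λ j → coprimePart p (λ d → dilate d g n) (suc j))

dilate-large : ∀ {d n} .{{_ : NonZero n}} g → n < d → dilate d g n ≡ 0ℤ
dilate-large g n<d = dilate-∤ g (>⇒∤ n<d)

-- No divisor of `n` exceeds `n`. Giving all n ≤ N the common range `N` makes the double sum over n
-- and d rectangular.
divisorSum-extend : ∀ {n N} .{{_ : NonZero n}} g → n ≤ N →
  ∑ N (λ j → dilate (suc j) g n) ≡ divisorSum g n
divisorSum-extend g n≤N = ∑-truncate _ n≤N λ j n≤j → dilate-large g (s≤s n≤j)

◃-* : ∀ s t → (s Sign.* t) ◃ 1 ≡ (s ◃ 1) ℤ.* (t ◃ 1)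
◃-* Sign.+ Sign.+ = refl
◃-* Sign.+ Sign.- = refl
◃-* Sign.- Sign.+ = refl
◃-* Sign.- Sign.- = refl

value : (ℕ → Sign) → ℕ → ℤ
value f n = f n ◃ 1

partialSum : (ℕ → Sign) → ℕ → ℤ
partialSum f N = ∑ N (value f ∘ suc)

-- For c and h the sums of f(n/d) over the divisors d of n prime to p and over all
-- divisors, with s = f p. Nonnegativity of h alone does not survive n ↦ np.
Balanced : Sign → ℤ → ℤ → Set
Balanced Sign.+ c h = 0ℤ ℤ.≤ h × 0ℤ ℤ.≤ c
Balanced Sign.- c h = 0ℤ ℤ.≤ h × c ℤ.≤ h

balanced-nonneg : ∀ s {c h} → Balanced s c h → 0ℤ ℤ.≤ h
balanced-nonneg Sign.+ (0≤h , _) = 0≤h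
balanced-nonneg Sign.- (0≤h , _) = 0≤h

balanced-diagonal : ∀ s {h} → 0ℤ ℤ.≤ h → Balanced s h h
balanced-diagonal Sign.+ 0≤h = 0≤h , 0≤h
balanced-diagonal Sign.- 0≤h = 0≤h , ℤ.≤-refl

-- The effect of one more factor p. For s = - the new h is h - c, nonnegative by c ≤ h, and the new
-- c is -c ≤ h - c by 0 ≤ h, so each inequality yields the other.
balanced-step : ∀ s {c h c′ h′} → c′ ≡ (s ◃ 1) ℤ.* c → h′ ≡ c′ ℤ.+ h →
  Balanced s c h → Balanced s c′ h′
balanced-step Sign.+ {c} refl refl (0≤h , 0≤c) rewrite ℤ.*-identityˡ c =
  ℤ.+-mono-≤ 0≤c 0≤h , 0≤c
balanced-step Sign.- {c} {h} refl refl (0≤h , c≤h) rewrite ℤ.-1*i≡-i c =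
  subst (0ℤ ℤ.≤_) (ℤ.+-comm h (ℤ.- c)) (ℤ.i≤j⇒0≤j-i c≤h) ,
  subst (ℤ._≤ ℤ.- c ℤ.+ h) (ℤ.+-identityʳ (ℤ.- c)) (ℤ.+-monoʳ-≤ (ℤ.- c) 0≤h)

module _ (f : ℕ → Sign) (f-* : CompletelyMultiplicative f) where
  private
    F : ℕ → ℤ
    F = value f

  F-* : ∀ a b .{{_ : NonZero a}} .{{_ : NonZero b}} → F (a * b) ≡ F a ℤ.* F b
  F-* a b = trans (cong (_◃ 1) (f-* a b)) (◃-* (f a) (f b))

  f1≡+ : f 1 ≡ Sign.+
  f1≡+ with f 1 | f-* 1 1
  ... | Sign.+ | _ = refl

  module _ {p} (p-prime : Prime p) where
    private instance
      p≢0 : NonZero p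
      p≢0 = prime⇒nonZero p-prime

    dilate-cancel : ∀ d .{{_ : NonZero d}} g n → dilate (d * p) g (n * p) ≡ dilate d g n
    dilate-cancel d g n with d ∣? n
    ... | yes (divides q refl) = trans (cong (dilate (d * p) g) (*-assoc q d p))
                                       (dilate-∣ (d * p) {{m*n≢0 d p}} g q)
    ... | no d∤n = dilate-∤ g (d∤n ∘ *-cancelʳ-∣ p)

    -- For d prime to p, Euclid's lemma shows that d divides np only if it divides n, and then
    -- f(np/d) = f(p) f(n/d).
    coprimePart-dilate-* : ∀ n .{{_ : NonZero n}} d .{{_ : NonZero d}} →
      coprimePart p (λ d → dilate d F (n * p)) d ≡
      F p ℤ.* coprimePart p (λ d → dilate d F n) d
    coprimePart-dilate-* n d with p ∣? d
    ... | yes _ = sym (ℤ.*-zeroʳ (F p))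
    ... | no p∤d with d ∣? n
    ...   | no d∤n = trans (dilate-∤ F d∤np) (sym (ℤ.*-zeroʳ (F p)))
      where
      d∤np : d ∤ n * p
      d∤np (divides q np≡qd) with euclidsLemma q d p-prime (divides n (sym np≡qd))
      ... | inj₂ p∣d = p∤d p∣d
      ... | inj₁ (divides r refl) = d∤n (divides r (*-cancelʳ-≡ n (r * d) p (begin
        n * p        ≡⟨ np≡qd ⟩
        r * p * d    ≡⟨ *-assoc r p d ⟩
        r * (p * d)  ≡⟨ cong (r *_) (*-comm p d) ⟩
        r * (d * p)  ≡⟨ *-assoc r d p ⟨
        r * d * p    ∎)))
        where open ≡-Reasoning
    ...   | yes (divides q refl) = begin
      dilate d F (q * d * p)    ≡⟨ cong (dilate d F) (*-assoc q d p) ⟩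
      dilate d F (q * (d * p))  ≡⟨ cong (λ x → dilate d F (q * x)) (*-comm d p) ⟩
      dilate d F (q * (p * d))  ≡⟨ cong (dilate d F) (*-assoc q p d) ⟨
      dilate d F (q * p * d)    ≡⟨ dilate-∣ d F (q * p) ⟩
      F (q * p)                 ≡⟨ cong F (*-comm q p) ⟩
      F (p * q)                 ≡⟨ F-* p q {{it}} {{m*n≢0⇒m≢0 q}} ⟩
      F p ℤ.* F q               ∎
      where
      open ≡-Reasoning

    coprimeDivisorSum-* : ∀ n .{{_ : NonZero n}} →
      coprimeDivisorSum p F (n * p) ≡ F p ℤ.* coprimeDivisorSum p F n
    coprimeDivisorSum-* n = begin
      ∑ (n * p) (λ j → coprimePart p (λ d → dilate d F (n * p)) (suc j))
        ≡⟨ ∑-cong (n * p) (λ j → coprimePart-dilate-* n (suc j)) ⟩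
      ∑ (n * p) (λ j → F p ℤ.* coprimePart p (λ d → dilate d F n) (suc j))
        ≡⟨ ∑-* (n * p) (F p) _ ⟩
      F p ℤ.* ∑ (n * p) (λ j → coprimePart p (λ d → dilate d F n) (suc j))
        ≡⟨ cong (F p ℤ.*_) (∑-truncate _ (m≤m*n n p) vanish) ⟩
      F p ℤ.* coprimeDivisorSum p F n ∎
      where
      open ≡-Reasoning
      vanish : ∀ j → n ≤ j → coprimePart p (λ d → dilate d F n) (suc j) ≡ 0ℤ
      vanish j n≤j with p ∣? suc j
      ... | yes _ = refl
      ... | no _  = dilate-large F (s≤s n≤j)

    -- The divisors of np that are multiples of p are the ep with e dividing n, and np/(ep) = n/e;
    -- they contribute the divisor sum of n.
    divisorSum-* : ∀ n →
      divisorSum F (n * p) ≡ coprimeDivisorSum p F (n * p) ℤ.+ divisorSum F n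
    divisorSum-* n = begin
      ∑ (n * p) (λ j → c (suc j))
        ≡⟨ ∑-cong (n * p) (λ j → coprimePart+dilate p c (suc j)) ⟩
      ∑ (n * p) (λ j → coprimePart p c (suc j) ℤ.+ dilate p (λ e → c (e * p)) (suc j))
        ≡⟨ ∑-+ (n * p) _ _ ⟩
      coprimeDivisorSum p F (n * p) ℤ.+ ∑ (n * p) (dilate p (λ e → c (e * p)) ∘ suc)
        ≡⟨ cong (ℤ._+_ (coprimeDivisorSum p F (n * p)))
                (∑-dilate-% p (λ e → c (e * p)) n 0 (>-nonZero⁻¹ p)) ⟩
      coprimeDivisorSum p F (n * p) ℤ.+ ∑ n (λ j → c (suc j * p))
        ≡⟨ cong (ℤ._+_ (coprimeDivisorSum p F (n * p)))
                (∑-cong n λ j → dilate-cancel (suc j) F n) ⟩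
      coprimeDivisorSum p F (n * p) ℤ.+ divisorSum F n ∎
      where
      open ≡-Reasoning
      c : ℕ → ℤ
      c d = dilate d F (n * p)

    coprimeDivisorSum-∤ : ∀ n .{{_ : NonZero n}} → p ∤ n →
      coprimeDivisorSum p F n ≡ divisorSum F n
    coprimeDivisorSum-∤ n p∤n = ∑-cong n λ j → pointwise (suc j)
      where
      pointwise : ∀ d → coprimePart p (λ d → dilate d F n) d ≡ dilate d F n
      pointwise d with p ∣? d
      ... | yes p∣d = sym (dilate-∤ F (p∤n ∘ ∣-trans p∣d))
      ... | no _    = refl

    Invariant : ℕ → Set
    Invariant n = Balanced (f p) (coprimeDivisorSum p F n) (divisorSum F n)

    invariant-∤ : ∀ n .{{_ : NonZero n}} → p ∤ n → 0ℤ ℤ.≤ divisorSum F n → Invariant n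
    invariant-∤ n p∤n 0≤h = subst (λ c → Balanced (f p) c (divisorSum F n))
      (sym (coprimeDivisorSum-∤ n p∤n)) (balanced-diagonal (f p) 0≤h)

    invariant-* : ∀ n .{{_ : NonZero n}} → Invariant n → Invariant (n * p)
    invariant-* n = balanced-step (f p) (coprimeDivisorSum-* n) (divisorSum-* n)

  -- Primes are stripped off n one at a time; which prime is stripped may change.
  mutual
    invariant : ∀ n .{{_ : NonZero n}} → Acc _<_ n → ∀ {p} (p-prime : Prime p) →
      Invariant p-prime n
    invariant n n-acc {p} p-prime with p ∣? n
    ... | no p∤n = invariant-∤ p-prime n p∤n (divisorSum-nonneg-acc n n-acc)
    ... | yes (divides m refl) = invariant-multiple m n-acc p-prime

    -- The only descent of the recursion: the other two functions pass on the same n, and here a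
    -- prime factor is removed from it.
    invariant-multiple : ∀ m {p} .{{_ : NonZero (m * p)}} → Acc _<_ (m * p) →
      (p-prime : Prime p) → Invariant p-prime (m * p)
    invariant-multiple m {p} (acc smaller) p-prime =
      invariant-* p-prime m (invariant m (smaller m<mp) p-prime)
      where
      instance
        m≢0 : NonZero m
        m≢0 = m*n≢0⇒m≢0 m
      m<mp : m < m * p
      m<mp = m<m*n m p (nonTrivial⇒n>1 p {{prime⇒nonTrivial p-prime}})

    divisorSum-nonneg-acc : ∀ n .{{_ : NonZero n}} → Acc _<_ n → 0ℤ ℤ.≤ divisorSum F n
    divisorSum-nonneg-acc n n-acc with factorise n
    ... | record { factors = [] ; isFactorisation = refl } =
      -- The empty factorisation means n = 1, where the divisor sum is f(1) = 1.
      subst (λ s → 0ℤ ℤ.≤ 0ℤ ℤ.+ (s ◃ 1)) (sym f1≡+) (ℤ.+≤+ z≤n)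
    ... | record { factors = p ∷ ps ; isFactorisation = n≡p*m ; factorsPrime = p-prime ∷ _ }
      with refl ← trans n≡p*m (*-comm p (product ps)) =
      balanced-nonneg (f p) (invariant-multiple (product ps) n-acc p-prime)

  divisorSum-nonneg : ∀ n .{{_ : NonZero n}} → 0ℤ ℤ.≤ divisorSum F n
  divisorSum-nonneg n = divisorSum-nonneg-acc n (<-wellFounded n)

  -- Summing (f ∗ 1)(n) over n ≤ N and exchanging the sums leaves, for each d, the sum of f over m ≤
  -- N/d.
  ∑-partialSums-nonneg : ∀ N → 0ℤ ℤ.≤ ∑ N (λ j → partialSum f (N / suc j))
  ∑-partialSums-nonneg N = subst (0ℤ ℤ.≤_) count (∑-nonneg N λ j j<N →
    subst (0ℤ ℤ.≤_) (sym (divisorSum-extend F j<N)) (divisorSum-nonneg (suc j)))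
    where
    count : ∑ N (λ n → ∑ N (λ j → dilate (suc j) F (suc n))) ≡
            ∑ N (λ j → partialSum f (N / suc j))
    count = trans (∑-swap N N (λ n j → dilate (suc j) F (suc n)))
                  (∑-cong N λ j → ∑-dilate (suc j) F N)

-- The upper bound

-- The argument `suc (n + j)`, rather than the `n + suc j` implicit in `negatives`, makes this
-- literally the tail in `∑-++`.
blockSum : (ℕ → Sign) → ℕ → ℕ → ℤ
blockSum f k n = ∑ k (λ j → value f (suc (n + j)))

partialSum-+ : ∀ f n k → partialSum f (n + k) ≡ partialSum f n ℤ.+ blockSum f k n
partialSum-+ f n k = ∑-++ n k (value f ∘ suc)

-- Each value -1 contributes 2 - 1 and each value +1 contributes 0 + 1, so every position counts
-- once.
negatives+blockSum : ∀ f k n → + (2 * negatives f k n) ℤ.+ blockSum f k n ≡ + k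
negatives+blockSum f zero    n = refl
negatives+blockSum f (suc k) n = begin
  + (2 * negatives f (suc k) n) ℤ.+ (B ℤ.+ value f (suc (n + k)))
    ≡⟨ cong₂ (λ c m → + (2 * c) ℤ.+ (B ℤ.+ value f m)) split (sym (+-suc n k)) ⟩
  + (2 * (negatives f k n + length (filter P? [ suc k ]))) ℤ.+ (B ℤ.+ value f (n + suc k))
    ≡⟨ cong (ℤ._+ (B ℤ.+ value f (n + suc k))) (cong +_ (*-distribˡ-+ 2 (negatives f k n) _)) ⟩
  (+ (2 * negatives f k n) ℤ.+ + (2 * length (filter P? [ suc k ]))) ℤ.+ (B ℤ.+ value f (n + suc k))
    ≡⟨ interchange ℤ.+-commutativeSemigroup (+ (2 * negatives f k n))
         (+ (2 * length (filter P? [ suc k ]))) B (value f (n + suc k)) ⟩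
  (+ (2 * negatives f k n) ℤ.+ B) ℤ.+ (+ (2 * length (filter P? [ suc k ])) ℤ.+ value f (n + suc k))
    ≡⟨ cong₂ ℤ._+_ (negatives+blockSum f k n) last ⟩
  + (k + 1)
    ≡⟨ cong +_ (+-comm k 1) ⟩
  + suc k ∎
  where
  open ≡-Reasoning
  B = blockSum f k n
  P? = λ m → f (n + m) Sign.≟ Sign.-
  split : negatives f (suc k) n ≡ negatives f k n + length (filter P? [ suc k ])
  split = begin
    length (filter P? (applyUpTo suc (suc k)))
      ≡⟨ cong (length ∘ filter P?) (applyUpTo-∷ʳ suc k) ⟨
    length (filter P? (applyUpTo suc k ++ [ suc k ]))
      ≡⟨ cong length (filter-++ P? (applyUpTo suc k) [ suc k ]) ⟩
    length (filter P? (applyUpTo suc k) ++ filter P? [ suc k ])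
      ≡⟨ length-++ (filter P? (applyUpTo suc k)) ⟩
    negatives f k n + length (filter P? [ suc k ]) ∎
  last : + (2 * length (filter P? [ suc k ])) ℤ.+ value f (n + suc k) ≡ 1ℤ
  last with f (n + suc k)
  ... | Sign.+ = refl
  ... | Sign.- = refl

-- Divergence of the harmonic series, in integers

2*[m/d]≤[m+m]/d : ∀ m d .{{_ : NonZero d}} → 2 * (m / d) ≤ (m + m) / d
2*[m/d]≤[m+m]/d m d = begin
  2 * (m / d)          ≡⟨ m*n/n≡m (2 * (m / d)) d ⟨
  2 * (m / d) * d / d  ≤⟨ /-monoˡ-≤ d (begin
    2 * (m / d) * d    ≡⟨ *-assoc 2 (m / d) d ⟩
    2 * (m / d * d)    ≤⟨ *-monoʳ-≤ 2 (m/n*n≤m m d) ⟩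
    2 * m              ≡⟨ cong (_+_ m) (+-identityʳ m) ⟩
    m + m              ∎) ⟩
  (m + m) / d          ∎
  where open ≤-Reasoning

-- A stand-in within ℤ for M times the M-th harmonic number.
harmonic : ℕ → ℤ
harmonic M = ∑ M (λ j → + (M / suc j))

-- For d ≤ M the floor at least doubles; each of the M terms with M < d ≤ 2M is at least 1.
harmonic-double : ∀ M → + 2 ℤ.* harmonic M ℤ.+ + M ℤ.≤ harmonic (M + M)
harmonic-double M = begin
  + 2 ℤ.* harmonic M ℤ.+ + M
    ≡⟨ cong₂ ℤ._+_ (∑-* M (+ 2) _) (trans (∑-const M 1ℤ) (ℤ.*-identityʳ (+ M))) ⟨
  ∑ M (λ j → + 2 ℤ.* + (M / suc j)) ℤ.+ ∑ M (λ _ → 1ℤ)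
    ≤⟨ ℤ.+-mono-≤ (∑-mono M λ j _ → double j)
                  (∑-mono M λ j j<M → ℤ.+≤+ (m≥n⇒m/n>0 (1+M+j≤2M j<M))) ⟩
  ∑ M (λ j → + ((M + M) / suc j)) ℤ.+ ∑ M (λ j → + ((M + M) / suc (M + j)))
    ≡⟨ ∑-++ M M _ ⟨
  harmonic (M + M) ∎
  where
  open ℤ.≤-Reasoning
  1+M+j≤2M : ∀ {j} → j < M → suc (M + j) ≤ M + M
  1+M+j≤2M {j} j<M = subst (_≤ M + M) (+-suc M j) (+-monoʳ-≤ M j<M)
  double : ∀ j → + 2 ℤ.* + (M / suc j) ℤ.≤ + ((M + M) / suc j)
  double j = subst (ℤ._≤ + ((M + M) / suc j)) (ℤ.pos-* 2 (M / suc j))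
    (ℤ.+≤+ (2*[m/d]≤[m+m]/d M (suc j)))

-- Oresme's bound: the harmonic number of 2^L is at least L/2. The factor 2 clears the denominator.
harmonic-2^ : ∀ L → + (L * 2 ^ L) ℤ.≤ + 2 ℤ.* harmonic (2 ^ L)
harmonic-2^ zero    = ℤ.+≤+ z≤n
harmonic-2^ (suc L) = begin
  + (suc L * (2 * M))
    ≡⟨ cong +_ (expand L M) ⟩
  + (2 * (L * M) + 2 * M)
    ≡⟨ cong₂ ℤ._+_ (ℤ.pos-* 2 (L * M)) (ℤ.pos-* 2 M) ⟩
  + 2 ℤ.* + (L * M) ℤ.+ + 2 ℤ.* + M
    ≤⟨ ℤ.+-monoˡ-≤ (+ 2 ℤ.* + M) (ℤ.*-monoˡ-≤-nonNeg (+ 2) (harmonic-2^ L)) ⟩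
  + 2 ℤ.* (+ 2 ℤ.* harmonic M) ℤ.+ + 2 ℤ.* + M
    ≡⟨ ℤ.*-distribˡ-+ (+ 2) (+ 2 ℤ.* harmonic M) (+ M) ⟨
  + 2 ℤ.* (+ 2 ℤ.* harmonic M ℤ.+ + M)
    ≤⟨ ℤ.*-monoˡ-≤-nonNeg (+ 2) (harmonic-double M) ⟩
  + 2 ℤ.* harmonic (M + M)
    ≡⟨ cong (λ m → + 2 ℤ.* harmonic (M + m)) (+-identityʳ M) ⟨
  + 2 ℤ.* harmonic (2 * M) ∎
  where
  open ℤ.≤-Reasoning
  M = 2 ^ L
  expand : ∀ L M → suc L * (2 * M) ≡ 2 * (L * M) + 2 * M
  expand = ℕ.solve-∀

-- Consequences of a negative sum over every block

module _ (f : ℕ → Sign) {k} .{{_ : NonZero k}}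
  (negative : ∀ n → blockSum f k n ℤ.≤ -1ℤ) where

  -- The first r values sum to at most r, and each of the q blocks after them to at most -1.
  partialSum-≤ : ∀ q r → partialSum f (r + q * k) ℤ.≤ + r ℤ.- + q
  partialSum-≤ zero r rewrite +-identityʳ r = begin
    partialSum f r    ≤⟨ ∑-mono r (λ j _ → ◃1≤1 (f (suc j))) ⟩
    ∑ r (λ _ → 1ℤ)    ≡⟨ ∑-const r 1ℤ ⟩
    + r ℤ.* 1ℤ        ≡⟨ ℤ.*-identityʳ (+ r) ⟩
    + r               ∎
    where
    open ℤ.≤-Reasoning
    ◃1≤1 : ∀ s → s ◃ 1 ℤ.≤ 1ℤ
    ◃1≤1 Sign.+ = ℤ.≤-refl
    ◃1≤1 Sign.- = ℤ.-≤+
  partialSum-≤ (suc q) r = begin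
    partialSum f (r + (k + q * k))
      ≡⟨ cong (partialSum f) (rearrange r k (q * k)) ⟩
    partialSum f (r + q * k + k)
      ≡⟨ partialSum-+ f (r + q * k) k ⟩
    partialSum f (r + q * k) ℤ.+ blockSum f k (r + q * k)
      ≤⟨ ℤ.+-mono-≤ (partialSum-≤ q r) (negative (r + q * k)) ⟩
    (+ r ℤ.- + q) ℤ.+ -1ℤ
      ≡⟨ ℤ.+-assoc (+ r) (ℤ.- + q) -1ℤ ⟩
    + r ℤ.+ (ℤ.- + q ℤ.+ -1ℤ)
      ≡⟨ cong (ℤ._+_ (+ r)) (trans (sym (ℤ.neg-distrib-+ (+ q) 1ℤ))
                                   (cong (λ m → ℤ.- + m) (+-comm q 1))) ⟩
    + r ℤ.- + suc q ∎
    where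
    open ℤ.≤-Reasoning
    rearrange : ∀ r k m → r + (k + m) ≡ r + m + k
    rearrange = ℕ.solve-∀

  -- Because `k * M` is a multiple of k, the nested floors collapse: the number of complete blocks
  -- up to kM/d is exactly the floor of M/d.
  partialSum-/-≤ : ∀ M d .{{_ : NonZero d}} → partialSum f (k * M / d) ℤ.≤ + k ℤ.- + (M / d)
  partialSum-/-≤ M d = begin
    partialSum f x
      ≡⟨ cong (partialSum f) (m≡m%n+[m/n]*n x k) ⟩
    partialSum f (x % k + x / k * k)
      ≤⟨ partialSum-≤ (x / k) (x % k) ⟩
    + (x % k) ℤ.- + (x / k)
      ≤⟨ ℤ.+-monoˡ-≤ (ℤ.- + (x / k)) (ℤ.+≤+ (m%n≤n x k)) ⟩
    + k ℤ.- + (x / k)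
      ≡⟨ cong (λ q → + k ℤ.- + q) x/k≡M/d ⟩
    + k ℤ.- + (M / d) ∎
    where
    open ℤ.≤-Reasoning
    x = k * M / d
    instance
      kd≢0 : NonZero (k * d)
      kd≢0 = m*n≢0 k d
      dk≢0 : NonZero (d * k)
      dk≢0 = m*n≢0 d k
    x/k≡M/d : x / k ≡ M / d
    x/k≡M/d = trans (m/n/o≡m/[n*o] (k * M) d k)
      (trans (/-congʳ (*-comm d k)) (m*n/m*o≡n/o k M d))

  -- The bounds k - M/d are summed over all d ≤ kM against the nonnegative total; the floors with d
  -- > M vanish, which leaves `harmonic M`.
  harmonic-≤ : CompletelyMultiplicative f → ∀ M → harmonic M ℤ.≤ + (k * M) ℤ.* + k
  harmonic-≤ f-* M = ℤ.0≤i-j⇒j≤i (begin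
    0ℤ
      ≤⟨ ∑-partialSums-nonneg f f-* N ⟩
    ∑ N (λ j → partialSum f (N / suc j))
      ≤⟨ ∑-mono N (λ j _ → partialSum-/-≤ M (suc j)) ⟩
    ∑ N (λ j → + k ℤ.- + (M / suc j))
      ≡⟨ ∑-+ N (λ _ → + k) _ ⟩
    ∑ N (λ _ → + k) ℤ.+ ∑ N (λ j → ℤ.- + (M / suc j))
      ≡⟨ cong₂ ℤ._+_ (∑-const N (+ k)) negate ⟩
    + N ℤ.* + k ℤ.- harmonic M ∎)
    where
    open ℤ.≤-Reasoning
    N = k * M
    vanish : ∀ j → M ≤ j → + (M / suc j) ≡ 0ℤ
    vanish j M≤j = cong +_ (m<n⇒m/n≡0 (s≤s M≤j))
    negate : ∑ N (λ j → ℤ.- + (M / suc j)) ≡ ℤ.- harmonic M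
    negate = begin-equality
      ∑ N (λ j → ℤ.- + (M / suc j))       ≡⟨ ∑-cong N (λ j → ℤ.-1*i≡-i (+ (M / suc j))) ⟨
      ∑ N (λ j → -1ℤ ℤ.* + (M / suc j))   ≡⟨ ∑-* N -1ℤ _ ⟩
      -1ℤ ℤ.* ∑ N (λ j → + (M / suc j))   ≡⟨ ℤ.-1*i≡-i _ ⟩
      ℤ.- ∑ N (λ j → + (M / suc j))       ≡⟨ cong ℤ.-_ (∑-truncate _ (m≤n*m M k) vanish) ⟩
      ℤ.- harmonic M                      ∎

  ¬all-blocks-negative : ¬ CompletelyMultiplicative f
  ¬all-blocks-negative f-* = 1+n≰n (*-cancelʳ-≤ _ (2 * (k * k)) M {{m^n≢0 2 L}}
    (ℤ.drop‿+≤+ (begin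
    + (suc (2 * (k * k)) * M)      ≤⟨ harmonic-2^ L ⟩
    + 2 ℤ.* harmonic M             ≤⟨ ℤ.*-monoˡ-≤-nonNeg (+ 2) (harmonic-≤ f-* M) ⟩
    + 2 ℤ.* (+ (k * M) ℤ.* + k)    ≡⟨ cong (ℤ._*_ (+ 2)) (ℤ.pos-* (k * M) k) ⟨
    + 2 ℤ.* + (k * M * k)          ≡⟨ ℤ.pos-* 2 (k * M * k) ⟨
    + (2 * (k * M * k))            ≡⟨ cong +_ (rearrange k M) ⟩
    + (2 * (k * k) * M)            ∎)))
    where
    open ℤ.≤-Reasoning
    -- The two bounds on `harmonic M` give L M ≤ 2k² M; this is the first L that violates it.
    L = suc (2 * (k * k))
    M = 2 ^ L
    rearrange : ∀ k M → 2 * (k * M * k) ≡ 2 * (k * k) * M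
    rearrange = ℕ.solve-∀

-- If 2e > k, every block has more than k/2 negatives, so its sum is negative and, being an integer,
-- at most -1.
minNegatives-≤ : ∀ f {k e} .{{_ : NonZero k}} → CompletelyMultiplicative f →
  IsMinNegatives f k e → 2 * e ≤ k
minNegatives-≤ f {k} {e} f-* (_ , e≤) with 2 * e ≤? k
... | yes 2e≤k = 2e≤k
... | no 2e≰k = contradiction f-* (¬all-blocks-negative f negative)
  where
  negative : ∀ n → blockSum f k n ℤ.≤ -1ℤ
  negative n = ℤ.i<j⇒i≤pred[j] {j = 0ℤ} (ℤ.≰⇒> {0ℤ} λ 0≤block →
    <⇒≱ (<-≤-trans (≰⇒> 2e≰k) (*-monoʳ-≤ 2 (e≤ n))) (ℤ.drop‿+≤+ (begin
      + (2 * negatives f k n)                     ≡⟨ ℤ.+-identityʳ (+ (2 * negatives f k n)) ⟨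
      + (2 * negatives f k n) ℤ.+ 0ℤ              ≤⟨ ℤ.+-monoʳ-≤ (+ (2 * negatives f k n)) 0≤block ⟩
      + (2 * negatives f k n) ℤ.+ blockSum f k n  ≡⟨ negatives+blockSum f k n ⟩
      + k                                         ∎)))
    where open ℤ.≤-Reasoning

delta-≤ : ∀ {k d} .{{_ : NonZero k}} → IsDelta k d → 2 * d ≤ k
delta-≤ {k} {d} (_ , least) = begin
  -- Upper bounds are compared within ℕ, so k/2 enters as its floor.
  2 * d        ≤⟨ *-monoʳ-≤ 2 (least (k / 2) ≤k/2) ⟩
  2 * (k / 2)  ≡⟨ *-comm 2 (k / 2) ⟩
  k / 2 * 2    ≤⟨ m/n*n≤m k 2 ⟩
  k            ∎
  where
  open ≤-Reasoning
  ≤k/2 : IsUpperBound (IsModifiedCharacterValue k) (k / 2)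
  ≤k/2 e (_ , _ , _ , f , _ , _ , f-modified , min) = begin
    e          ≡⟨ m*n/n≡m e 2 ⟨
    e * 2 / 2  ≡⟨ cong (_/ 2) (*-comm e 2) ⟩
    2 * e / 2  ≤⟨ /-monoˡ-≤ 2 (minNegatives-≤ f (completelyMultiplicative f-modified) min) ⟩
    k / 2      ∎
    where open IsModifiedCharacter

-- The lower bound

χ₃ : ℕ → ℤ
χ₃ 0 = 0ℤ
χ₃ 1 = 1ℤ
χ₃ 2 = -1ℤ
χ₃ (suc (suc (suc n))) = χ₃ n

χ₃-real : ∀ n → χ₃ n ≡ 0ℤ ⊎ χ₃ n ≡ 1ℤ ⊎ χ₃ n ≡ -1ℤ
χ₃-real 0 = inj₁ refl
χ₃-real 1 = inj₂ (inj₁ refl)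
χ₃-real 2 = inj₂ (inj₂ refl)
χ₃-real (suc (suc (suc n))) = χ₃-real n

χ₃≡0⇒3∣ : ∀ n → χ₃ n ≡ 0ℤ → 3 ∣ n
χ₃≡0⇒3∣ 0 _ = 3 ∣0
χ₃≡0⇒3∣ (suc (suc (suc n))) eq = ∣m∣n⇒∣m+n ∣-refl (χ₃≡0⇒3∣ n eq)

χ₃-3*+ : ∀ m n → χ₃ (m * 3 + n) ≡ χ₃ n
χ₃-3*+ zero    n = refl
χ₃-3*+ (suc m) n = χ₃-3*+ m n

3∣⇒χ₃≡0 : ∀ {n} → 3 ∣ n → χ₃ n ≡ 0ℤ
3∣⇒χ₃≡0 (divides q refl) = trans (cong χ₃ (sym (+-identityʳ (q * 3)))) (χ₃-3*+ q 0)

χ₃-double : ∀ n → χ₃ (n + n) ≡ ℤ.- χ₃ n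
χ₃-double 0 = refl
χ₃-double 1 = refl
χ₃-double 2 = refl
χ₃-double (suc (suc (suc n))) = begin
  χ₃ (n + (3 + n))  ≡⟨ cong χ₃ (rearrange n) ⟩
  χ₃ (3 + (n + n))  ≡⟨ χ₃-double n ⟩
  ℤ.- χ₃ n          ∎
  where
  open ≡-Reasoning
  rearrange : ∀ n → n + (3 + n) ≡ 3 + (n + n)
  rearrange = ℕ.solve-∀

-- Since (a + 3) b = 3b + ab, periodicity reduces the claim to a = 0, 1, 2.
χ₃-* : ∀ a b → χ₃ (a * b) ≡ χ₃ a ℤ.* χ₃ b
χ₃-* 0 b = sym (ℤ.*-zeroˡ (χ₃ b))
χ₃-* 1 b = trans (cong χ₃ (+-identityʳ b)) (sym (ℤ.*-identityˡ (χ₃ b)))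
χ₃-* 2 b = begin
  χ₃ (b + (b + 0))  ≡⟨ cong (λ c → χ₃ (b + c)) (+-identityʳ b) ⟩
  χ₃ (b + b)        ≡⟨ χ₃-double b ⟩
  ℤ.- χ₃ b          ≡⟨ ℤ.-1*i≡-i (χ₃ b) ⟨
  -1ℤ ℤ.* χ₃ b      ∎
  where open ≡-Reasoning
χ₃-* (suc (suc (suc a))) b = begin
  χ₃ (b + (b + (b + a * b)))  ≡⟨ cong χ₃ (rearrange b (a * b)) ⟩
  χ₃ (b * 3 + a * b)          ≡⟨ χ₃-3*+ b (a * b) ⟩
  χ₃ (a * b)                  ≡⟨ χ₃-* a b ⟩
  χ₃ a ℤ.* χ₃ b               ∎
  where
  open ≡-Reasoning
  rearrange : ∀ b c → b + (b + (b + c)) ≡ b * 3 + c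
  rearrange = ℕ.solve-∀

3-prime : Prime 3
3-prime = toWitness {a? = prime? 3} _

χ₃-isRealDirichletCharacter : IsRealDirichletCharacter 3 χ₃
χ₃-isRealDirichletCharacter = record
  { periodic       = λ n → cong χ₃ (+-comm n 3)
  ; multiplicative = χ₃-*
  ; support        = λ n → mk⇔ (coprime n) (nonzero n)
  ; real           = χ₃-real
  }
  where
  coprime : ∀ n → χ₃ n ≢ 0ℤ → Coprime n 3
  coprime n χ₃n≢0 (d∣n , d∣3) with prime⇒irreducible 3-prime d∣3
  ... | inj₁ d≡1  = d≡1
  ... | inj₂ refl = contradiction (3∣⇒χ₃≡0 d∣n) χ₃n≢0
  nonzero : ∀ n → Coprime n 3 → χ₃ n ≢ 0ℤ
  nonzero n n⊥3 χ₃n≡0 with () ← n⊥3 (χ₃≡0⇒3∣ n χ₃n≡0 , ∣-refl)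

-- The modified character extending `χ₃` by +1 at 3

f₃-fuel : ℕ → ℕ → Sign
f₃-fuel zero    n = Sign.+
f₃-fuel (suc s) n with 3 ∣? n
... | yes (divides q _) = f₃-fuel s q
... | no _              = ℤ.sign (χ₃ n)

-- The fuel n suffices, each division by 3 using up one unit.
f₃ : ℕ → Sign
f₃ n = f₃-fuel n n

q<q*3 : ∀ q .{{_ : NonZero q}} → q < q * 3
q<q*3 q = m<m*n q 3 (s≤s (s≤s z≤n))

-- Unfolding `f₃ (q * 3)` reaches `q` with more fuel than `f₃ q` starts with; the results agree
-- because division by 3 lowers n by at least the one unit spent.
f₃-fuel-irrelevant : ∀ {s t} n .{{_ : NonZero n}} → n ≤ s → n ≤ t → f₃-fuel s n ≡ f₃-fuel t n
f₃-fuel-irrelevant {zero}  {t}     (suc _) () _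
f₃-fuel-irrelevant {suc s} {zero}  (suc _) _ ()
f₃-fuel-irrelevant {suc s} {suc t} n n≤s n≤t with 3 ∣? n
... | no _ = refl
... | yes (divides q refl) = f₃-fuel-irrelevant q
  (s≤s⁻¹ (<-≤-trans (q<q*3 q) n≤s)) (s≤s⁻¹ (<-≤-trans (q<q*3 q) n≤t))
  where instance
    q≢0 : NonZero q
    q≢0 = m*n≢0⇒m≢0 q

f₃-*3 : ∀ q .{{_ : NonZero q}} → f₃ (q * 3) ≡ f₃ q
f₃-*3 (suc q) with 3 ∣? (suc q * 3)
... | no 3∤   = contradiction (divides (suc q) refl) 3∤
... | yes (divides q′ eq) with refl ← *-cancelʳ-≡ (suc q) q′ 3 eq =
  f₃-fuel-irrelevant (suc q) (s≤s⁻¹ (q<q*3 (suc q))) ≤-refl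

f₃-∤ : ∀ n → 3 ∤ n → value f₃ n ≡ χ₃ n
f₃-∤ zero    3∤n = contradiction (3 ∣0) 3∤n
f₃-∤ (suc n) 3∤n with 3 ∣? suc n
... | yes 3∣n = contradiction 3∣n 3∤n
... | no _ with χ₃ (suc n) in eq | χ₃-real (suc n)
-- The value 0, to which `ℤ.sign` assigns +, occurs only at multiples of 3.
...   | _ | inj₁ refl        = contradiction (χ₃≡0⇒3∣ (suc n) eq) 3∤n
...   | _ | inj₂ (inj₁ refl) = refl
...   | _ | inj₂ (inj₂ refl) = refl

3-adic-induction : (P : ℕ → Set) → (∀ n → 3 ∤ n → P n) →
  (∀ q .{{_ : NonZero q}} → P q → P (q * 3)) → ∀ n .{{_ : NonZero n}} → P n
3-adic-induction P P-∤ P-* n = go n (<-wellFounded n)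
  where
  go : ∀ n .{{_ : NonZero n}} → Acc _<_ n → P n
  go n (acc smaller) with 3 ∣? n
  ... | no 3∤n = P-∤ n 3∤n
  ... | yes (divides q refl) = P-* q (go q (smaller (q<q*3 q)))
    where instance
      q≢0 : NonZero q
      q≢0 = m*n≢0⇒m≢0 q

-- Factors 3 are stripped first from a, then from b; what remains is the multiplicativity of `χ₃`
-- away from 3.
f₃-* : CompletelyMultiplicative f₃
f₃-* a b = 3-adic-induction
  (λ a → .{{_ : NonZero a}} → f₃ (a * b) ≡ f₃ a Sign.* f₃ b) f₃-∤-* f₃-*3-* a
  where
  f₃-*3-* : ∀ q .{{_ : NonZero q}} →
    (.{{_ : NonZero q}} → f₃ (q * b) ≡ f₃ q Sign.* f₃ b) →
    .{{_ : NonZero (q * 3)}} → f₃ (q * 3 * b) ≡ f₃ (q * 3) Sign.* f₃ b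
  f₃-*3-* q ih = begin
    f₃ (q * 3 * b)           ≡⟨ cong f₃ (rearrange q b) ⟩
    f₃ (q * b * 3)           ≡⟨ f₃-*3 (q * b) {{m*n≢0 q b}} ⟩
    f₃ (q * b)               ≡⟨ ih ⟩
    f₃ q Sign.* f₃ b         ≡⟨ cong (Sign._* f₃ b) (f₃-*3 q) ⟨
    f₃ (q * 3) Sign.* f₃ b   ∎
    where
    open ≡-Reasoning
    rearrange : ∀ q b → q * 3 * b ≡ q * b * 3
    rearrange = ℕ.solve-∀
  f₃-∤-* : ∀ a → 3 ∤ a → .{{_ : NonZero a}} → f₃ (a * b) ≡ f₃ a Sign.* f₃ b
  f₃-∤-* a 3∤a = 3-adic-induction (λ b → f₃ (a * b) ≡ f₃ a Sign.* f₃ b) both-∤ step b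
    where
    open ≡-Reasoning
    both-∤ : ∀ b → 3 ∤ b → f₃ (a * b) ≡ f₃ a Sign.* f₃ b
    both-∤ b 3∤b = ℤ.sign-cong {1} {1} (begin
      value f₃ (a * b)              ≡⟨ f₃-∤ (a * b) 3∤ab ⟩
      χ₃ (a * b)                    ≡⟨ χ₃-* a b ⟩
      χ₃ a ℤ.* χ₃ b                 ≡⟨ cong₂ ℤ._*_ (f₃-∤ a 3∤a) (f₃-∤ b 3∤b) ⟨
      value f₃ a ℤ.* value f₃ b     ≡⟨ ◃-* (f₃ a) (f₃ b) ⟨
      (f₃ a Sign.* f₃ b) ◃ 1        ∎)
      where
      3∤ab : 3 ∤ a * b
      3∤ab 3∣ab with euclidsLemma a b 3-prime 3∣ab
      ... | inj₁ 3∣a = 3∤a 3∣a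
      ... | inj₂ 3∣b = 3∤b 3∣b
    step : ∀ q .{{_ : NonZero q}} → f₃ (a * q) ≡ f₃ a Sign.* f₃ q →
      f₃ (a * (q * 3)) ≡ f₃ a Sign.* f₃ (q * 3)
    step q ih = begin
      f₃ (a * (q * 3))         ≡⟨ cong f₃ (*-assoc a q 3) ⟨
      f₃ (a * q * 3)           ≡⟨ f₃-*3 (a * q) {{m*n≢0 a q}} ⟩
      f₃ (a * q)               ≡⟨ ih ⟩
      f₃ a Sign.* f₃ q         ≡⟨ cong (f₃ a Sign.*_) (f₃-*3 q) ⟨
      f₃ a Sign.* f₃ (q * 3)   ∎

-- With `f₃` itself as the choice of signs, the condition at the prime 3 is trivial.
f₃-isModifiedCharacter : IsModifiedCharacter 3 χ₃ f₃ f₃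
f₃-isModifiedCharacter = record
  { completelyMultiplicative = f₃-*
  ; unmodified = λ p p-prime ∤3 → f₃-∤ p (p∤3 p p-prime ∤3)
  ; modified   = λ _ _ _ → refl
  }
  where
  p∤3 : ∀ p → Prime p → p ∤ 3 → 3 ∤ p
  p∤3 p p-prime ∤3 3∣p with prime⇒irreducible p-prime 3∣p
  ... | inj₂ refl = ∤3 ∣-refl

-- Exactly one summand is nonzero: `χ₃` off the multiples of 3, and the dilated `f₃` on them, since
-- `f₃ 3` is +.
value-f₃ : ∀ n .{{_ : NonZero n}} → value f₃ n ≡ χ₃ n ℤ.+ dilate 3 (value f₃) n
value-f₃ = 3-adic-induction (λ n → value f₃ n ≡ χ₃ n ℤ.+ dilate 3 (value f₃) n)
  (λ n 3∤n → begin
    value f₃ n                            ≡⟨ f₃-∤ n 3∤n ⟩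
    χ₃ n                                  ≡⟨ ℤ.+-identityʳ (χ₃ n) ⟨
    χ₃ n ℤ.+ 0ℤ                           ≡⟨ cong (ℤ._+_ (χ₃ n)) (dilate-∤ (value f₃) 3∤n) ⟨
    χ₃ n ℤ.+ dilate 3 (value f₃) n        ∎)
  (λ q _ → begin
    value f₃ (q * 3)                      ≡⟨ cong (_◃ 1) (f₃-*3 q) ⟩
    value f₃ q                            ≡⟨ dilate-∣ 3 (value f₃) q ⟨
    dilate 3 (value f₃) (q * 3)           ≡⟨ ℤ.+-identityˡ _ ⟨
    0ℤ ℤ.+ dilate 3 (value f₃) (q * 3)
      ≡⟨ cong (ℤ._+ dilate 3 (value f₃) (q * 3)) (3∣⇒χ₃≡0 (divides q refl)) ⟨
    χ₃ (q * 3) ℤ.+ dilate 3 (value f₃) (q * 3) ∎)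
  where open ≡-Reasoning

-- Logarithmic bound for the block sums of `f₃`

∑χ₃ : ℕ → ℤ
∑χ₃ N = ∑ N (χ₃ ∘ suc)

-- A full period contributes 1 - 1 + 0 = 0, so only N modulo 3 matters.
∑χ₃∈0,1 : ∀ N → ∑χ₃ N ≡ 0ℤ ⊎ ∑χ₃ N ≡ 1ℤ
∑χ₃∈0,1 0 = inj₁ refl
∑χ₃∈0,1 1 = inj₂ refl
∑χ₃∈0,1 2 = inj₁ refl
∑χ₃∈0,1 (suc (suc (suc N))) = subst (λ s → s ≡ 0ℤ ⊎ s ≡ 1ℤ) (sym (∑-++ 3 N (χ₃ ∘ suc)))
  (subst (λ s → s ≡ 0ℤ ⊎ s ≡ 1ℤ) (sym (ℤ.+-identityˡ _)) (∑χ₃∈0,1 N))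

∣∑χ₃-∑χ₃∣≤1 : ∀ M N → ℤ.∣ ∑χ₃ M ℤ.- ∑χ₃ N ∣ ≤ 1
∣∑χ₃-∑χ₃∣≤1 M N with ∑χ₃ M | ∑χ₃∈0,1 M | ∑χ₃ N | ∑χ₃∈0,1 N
... | _ | inj₁ refl | _ | inj₁ refl = z≤n
... | _ | inj₁ refl | _ | inj₂ refl = ≤-refl
... | _ | inj₂ refl | _ | inj₁ refl = ≤-refl
... | _ | inj₂ refl | _ | inj₂ refl = z≤n

partialSum-f₃ : ∀ N → partialSum f₃ N ≡ ∑χ₃ N ℤ.+ partialSum f₃ (N / 3)
partialSum-f₃ N = begin
  partialSum f₃ N
    ≡⟨ ∑-cong N (λ j → value-f₃ (suc j)) ⟩
  ∑ N (λ j → χ₃ (suc j) ℤ.+ dilate 3 (value f₃) (suc j))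
    ≡⟨ ∑-+ N _ _ ⟩
  ∑χ₃ N ℤ.+ ∑ N (dilate 3 (value f₃) ∘ suc)
    ≡⟨ cong (ℤ._+_ (∑χ₃ N)) (∑-dilate 3 (value f₃) N) ⟩
  ∑χ₃ N ℤ.+ partialSum f₃ (N / 3) ∎
  where open ≡-Reasoning

blockSum-difference : ∀ f k n → blockSum f k n ≡ partialSum f (n + k) ℤ.- partialSum f n
blockSum-difference f k n = trans (cancel (partialSum f n) (blockSum f k n))
  (cong (ℤ._- partialSum f n) (sym (partialSum-+ f n k)))
  where
  cancel : ∀ a b → b ≡ (a ℤ.+ b) ℤ.- a
  cancel = ℤ.solve-∀

-- The number of multiples of 3 among n + 1, ..., n + k, hence the length of the block that they
-- form after division by 3.
third : ℕ → ℕ → ℕ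
third k n = (n + k) / 3 ∸ n / 3

n/3+third : ∀ k n → n / 3 + third k n ≡ (n + k) / 3
n/3+third k n = m+[n∸m]≡n (/-monoˡ-≤ 3 (m≤m+n n k))

third-≤ : ∀ k n → third k n * 3 ≤ 2 + k
third-≤ k n = +-cancelˡ-≤ (n / 3 * 3) _ _ (begin
  n / 3 * 3 + third k n * 3      ≡⟨ *-distribʳ-+ 3 (n / 3) (third k n) ⟨
  (n / 3 + third k n) * 3        ≡⟨ cong (_* 3) (n/3+third k n) ⟩
  (n + k) / 3 * 3                ≤⟨ m/n*n≤m (n + k) 3 ⟩
  n + k                          ≡⟨ cong (_+ k) (m≡m%n+[m/n]*n n 3) ⟩
  n % 3 + n / 3 * 3 + k          ≤⟨ +-monoˡ-≤ k (+-monoˡ-≤ (n / 3 * 3) (s≤s⁻¹ (m%n<n n 3))) ⟩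
  2 + n / 3 * 3 + k              ≡⟨ rearrange (n / 3 * 3) k ⟩
  n / 3 * 3 + (2 + k)            ∎)
  where
  open ≤-Reasoning
  rearrange : ∀ m k → 2 + m + k ≡ m + (2 + k)
  rearrange = ℕ.solve-∀

-- If 2t > k, then 3t ≤ k + 2 forces t ≤ 1, contrary to k ≥ 2. A block of length 1 may consist of a
-- multiple of 3, and then does not shrink.
2*third≤ : ∀ {k} n → 2 ≤ k → 2 * third k n ≤ k
2*third≤ {k} n 2≤k = ≮⇒≥ λ k<2t → <⇒≱ k<2t (≤-trans (*-monoʳ-≤ 2 (t≤1 k<2t)) 2≤k)
  where
  t = third k n
  open ≤-Reasoning
  t≤1 : k < 2 * t → t ≤ 1
  t≤1 k<2t = +-cancelˡ-≤ (suc k) t 1 (begin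
    suc k + t  ≤⟨ +-monoˡ-≤ t k<2t ⟩
    2 * t + t  ≡⟨ triple t ⟩
    t * 3      ≤⟨ third-≤ k n ⟩
    2 + k      ≡⟨ +-comm 1 (suc k) ⟩
    suc k + 1  ∎)
    where
    triple : ∀ t → 2 * t + t ≡ t * 3
    triple = ℕ.solve-∀

blockSum-f₃ : ∀ k n → blockSum f₃ k n ≡
  (∑χ₃ (n + k) ℤ.- ∑χ₃ n) ℤ.+ blockSum f₃ (third k n) (n / 3)
blockSum-f₃ k n = begin
  blockSum f₃ k n
    ≡⟨ blockSum-difference f₃ k n ⟩
  S (n + k) ℤ.- S n
    ≡⟨ cong₂ ℤ._-_ (partialSum-f₃ (n + k)) (partialSum-f₃ n) ⟩
  (∑χ₃ (n + k) ℤ.+ S ((n + k) / 3)) ℤ.- (∑χ₃ n ℤ.+ S (n / 3))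
    ≡⟨ exchange (∑χ₃ (n + k)) (S ((n + k) / 3)) (∑χ₃ n) (S (n / 3)) ⟩
  X ℤ.+ (S ((n + k) / 3) ℤ.- S (n / 3))
    ≡⟨ cong (λ m → X ℤ.+ (S m ℤ.- S (n / 3))) (n/3+third k n) ⟨
  X ℤ.+ (S (n / 3 + third k n) ℤ.- S (n / 3))
    ≡⟨ cong (ℤ._+_ X) (blockSum-difference f₃ (third k n) (n / 3)) ⟨
  X ℤ.+ blockSum f₃ (third k n) (n / 3) ∎
  where
  open ≡-Reasoning
  S = partialSum f₃
  X = ∑χ₃ (n + k) ℤ.- ∑χ₃ n
  exchange : ∀ a b c d → (a ℤ.+ b) ℤ.- (c ℤ.+ d) ≡ (a ℤ.- c) ℤ.+ (b ℤ.- d)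
  exchange = ℤ.solve-∀

∣blockSum-f₃∣≤1+third : ∀ k n →
  ℤ.∣ blockSum f₃ k n ∣ ≤ 1 + ℤ.∣ blockSum f₃ (third k n) (n / 3) ∣
∣blockSum-f₃∣≤1+third k n = begin
  ℤ.∣ blockSum f₃ k n ∣
    ≡⟨ cong ℤ.∣_∣ (blockSum-f₃ k n) ⟩
  ℤ.∣ (∑χ₃ (n + k) ℤ.- ∑χ₃ n) ℤ.+ blockSum f₃ (third k n) (n / 3) ∣
    ≤⟨ ℤ.∣i+j∣≤∣i∣+∣j∣ (∑χ₃ (n + k) ℤ.- ∑χ₃ n) (blockSum f₃ (third k n) (n / 3)) ⟩
  ℤ.∣ ∑χ₃ (n + k) ℤ.- ∑χ₃ n ∣ + ℤ.∣ blockSum f₃ (third k n) (n / 3) ∣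
    ≤⟨ +-monoˡ-≤ ℤ.∣ blockSum f₃ (third k n) (n / 3) ∣ (∣∑χ₃-∑χ₃∣≤1 (n + k) n) ⟩
  1 + ℤ.∣ blockSum f₃ (third k n) (n / 3) ∣ ∎
  where open ≤-Reasoning

-- Each passage to the multiples of 3 costs at most 1 and at least halves the length, so the binary
-- logarithm pays for it.
∣blockSum-f₃∣≤ : ∀ k .{{_ : NonZero k}} n → ℤ.∣ blockSum f₃ k n ∣ ≤ 1 + ⌊log₂ k ⌋
∣blockSum-f₃∣≤ k n = go k n (<-wellFounded k)
  where
  open ≤-Reasoning
  go : ∀ k .{{_ : NonZero k}} n → Acc _<_ k → ℤ.∣ blockSum f₃ k n ∣ ≤ 1 + ⌊log₂ k ⌋
  go 1 n _ with f₃ (suc (n + 0))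
  ... | Sign.+ = s≤s z≤n
  ... | Sign.- = s≤s z≤n
  go k@(suc (suc _)) n (acc smaller) with third k n in eq | ∣blockSum-f₃∣≤1+third k n
  -- Without a multiple of 3 in the block, the remaining sum is empty.
  ... | zero  | recurrence = ≤-trans recurrence (s≤s z≤n)
  ... | suc t | recurrence = ≤-trans recurrence (s≤s (begin
    ℤ.∣ blockSum f₃ (suc t) (n / 3) ∣  ≤⟨ go (suc t) (n / 3) (smaller 1+t<k) ⟩
    1 + ⌊log₂ suc t ⌋                  ≡⟨ ⌊log₂[2*b]⌋≡1+⌊log₂b⌋ (suc t) ⟨
    ⌊log₂ 2 * suc t ⌋                  ≤⟨ ⌊log₂⌋-mono-≤ 2t≤k ⟩
    ⌊log₂ k ⌋                          ∎))
    where
    2t≤k : 2 * suc t ≤ k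
    2t≤k = subst (λ t → 2 * t ≤ k) eq (2*third≤ n (s≤s (s≤s z≤n)))
    1+t<k : suc t < k
    1+t<k = <-≤-trans (m<m*n (suc t) 2 (s≤s (s≤s z≤n)))
                      (≤-trans (≤-reflexive (*-comm (suc t) 2)) 2t≤k)

≤-delta : ∀ {k d} .{{_ : NonZero k}} → IsDelta k d → k ≤ 2 * d + (1 + ⌊log₂ k ⌋)
-- The minimum for `f₃` exists only up to double negation, which the decidability of the inequality
-- absorbs.
≤-delta {k} {d} (upper , _) = decidable-stable (_ ≤? _) λ k≰ →
  minNegatives-exists f₃ k λ (e , min@((n , negatives≡e) , _)) → k≰ (ℤ.drop‿+≤+ (begin
    + k
      ≡⟨ negatives+blockSum f₃ k n ⟨
    + (2 * negatives f₃ k n) ℤ.+ blockSum f₃ k n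
      ≤⟨ ℤ.+-mono-≤
           (ℤ.+≤+ (*-monoʳ-≤ 2 (≤-trans (≤-reflexive negatives≡e) (upper e (f₃-value min)))))
           (ℤ.≤-trans (i≤∣i∣ (blockSum f₃ k n)) (ℤ.+≤+ (∣blockSum-f₃∣≤ k n))) ⟩
    + (2 * d + (1 + ⌊log₂ k ⌋)) ∎))
  where
  open ℤ.≤-Reasoning
  f₃-value : ∀ {e} → IsMinNegatives f₃ k e → IsModifiedCharacterValue k e
  f₃-value min = 3 , χ₃ , f₃ , f₃ , s≤s (s≤s z≤n) ,
    χ₃-isRealDirichletCharacter , f₃-isModifiedCharacter , min
  i≤∣i∣ : ∀ i → i ℤ.≤ + ℤ.∣ i ∣
  i≤∣i∣ (+ n)      = ℤ.≤-refl
  i≤∣i∣ ℤ.-[1+ n ] = ℤ.-≤+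

theorem1p2 : ∃[ C ] (∀ (k : ℕ) → 1 ≤ k → ∀ (d : ℕ) → IsDelta k d →
    ∣ 2 * d - k ∣ ≤ C * ⌊log₂ (suc k) ⌋)
-- One copy of the logarithm bounds `⌊log₂ k ⌋`; the other absorbs the summand 1, as k + 1 ≥ 2.
theorem1p2 = 2 , λ { k@(suc _) 1≤k d δ → begin
  ∣ 2 * d - k ∣                        ≡⟨ m≤n⇒∣m-n∣≡n∸m (delta-≤ δ) ⟩
  k ∸ 2 * d                            ≤⟨ m≤n+o⇒m∸n≤o k (2 * d) (≤-delta δ) ⟩
  1 + ⌊log₂ k ⌋                        ≤⟨ +-mono-≤ (⌊log₂⌋-mono-≤ (s≤s 1≤k))
                                                   (⌊log₂⌋-mono-≤ (n≤1+n k)) ⟩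
  ⌊log₂ suc k ⌋ + ⌊log₂ suc k ⌋        ≡⟨ cong (_+_ ⌊log₂ suc k ⌋) (+-identityʳ ⌊log₂ suc k ⌋) ⟨
  2 * ⌊log₂ suc k ⌋                    ∎ }
  where open ≤-Reasoning
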